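{- Let $G=(V,E)$ be a digraph. Then $G^{\top\bot}$ has the Hobby–McKenzie property if and only if $G$ has the Hobby–McKenzie property.
   Context: Digraphs are finite and loopless. $G^\top$ is the digraph on $V\cup\{\top\}$ with edges $E\cup\{(v,\top):v\in V\}$; $G^\bot$ is the digraph on $V\cup\{\bot\}$ with edges $E\cup\{(\bot,v):v\in V\}$; $G^{\top\bot}=(G^\top)^\bot$. A polymorphism is a map $f:V^k\to V$ with $(f(a_1,\dots,a_k),f(b_1,\dots,b_k))\in E$ whenever all $(a_i,b_i)\in E$. A digraph has the Hobby–McKenzie property if there are $n\ge0$ and idempotent ternary polymorphisms $d_0,\dots,d_n,p,e_0,\dots,e_n$ satisfying, for all vertices: $x=d_0(x,y,z)$, $e_n(x,y,z)=z$; $d_i(x,y,y)=d_{i+1}(x,y,y)$ and $e_i(x,y,y)=e_{i+1}(x,y,y)$ for even $i<n$; $d_i(x,x,y)=d_{i+1}(x,x,y)$ and $e_i(x,x,y)=e_{i+1}(x,x,y)$ for odd $i<n$; $d_n(x,y,y)=p(x,y,y)$ and $p(x,x,y)=e_0(x,x,y)$; $d_i(x,y,x)=d_{i+1}(x,y,x)$ for odd $i<n$ and $e_j(x,y,x)=e_{j+1}(x,y,x)$ for even $j<n$. -}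

module Defs where

open import Data.Fin.Base using (Fin; zero; suc; toℕ; fromℕ; inject₁)
open import Data.Maybe.Base using (Maybe; just; nothing)
open import Data.Nat.Base using (ℕ; suc)
open import Data.Nat.Divisibility using (_∣_; _∤_)
open import Data.Product.Base using (_×_)
open import Data.Vec.Base using (Vec; []; _∷_; replicate)
open import Data.Vec.Relation.Binary.Pointwise.Inductive using (Pointwise)
open import Function.Bundles using (_↔_; mk↔ₛ′; Inverse)
open import Level using (0ℓ)
open import Relation.Binary.Construct.Add.Infimum.Strict using (_<₋_; <₋-dec; <₋-irrefl-≡)
open import Relation.Binary.Construct.Add.Supremum.Strict using (_<⁺_; <⁺-dec; <⁺-irrefl-≡)
open import Relation.Binary.Core using (Rel)
open import Relation.Binary.Definitions using (Decidable; Irreflexive)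
open import Relation.Binary.PropositionalEquality using (_≡_; refl; cong)
open import Relation.Nullary.Construct.Add.Infimum using (_₋)
open import Relation.Nullary.Construct.Add.Supremum using (_⁺)

-- Edges are given by a relation, of which only inhabitedness matters.  Finite
-- data are decidable, hence the field _E?_.  The vertex set may be empty.
record Digraph : Set₁ where
  infix 4 _E_ _E?_
  field
    V      : Set
    size   : ℕ
    finite : V ↔ Fin size
    _E_    : Rel V 0ℓ
    _E?_   : Decidable _E_
    irrefl : Irreflexive _≡_ _E_

private
  Maybe-finite : ∀ {A : Set} {n} → A ↔ Fin n → Maybe A ↔ Fin (suc n)
  Maybe-finite {A} {n} A↔Fin = mk↔ₛ′ to′ from′ to′∘from′ from′∘to′
    where
    open Inverse A↔Fin

    to′ : Maybe A → Fin (suc n)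
    to′ nothing  = zero
    to′ (just a) = suc (to a)

    from′ : Fin (suc n) → Maybe A
    from′ zero    = nothing
    from′ (suc i) = just (from i)

    to′∘from′ : ∀ i → to′ (from′ i) ≡ i
    to′∘from′ zero    = refl
    to′∘from′ (suc i) = cong suc (strictlyInverseˡ i)

    from′∘to′ : ∀ a → from′ (to′ a) ≡ a
    from′∘to′ nothing  = refl
    from′∘to′ (just a) = cong just (strictlyInverseʳ a)

infix 25 _^⊤ _^⊥ _^⊤⊥

-- The library's extension of a strict order by a supremum, _<⁺_, is defined
-- for arbitrary relations: it adds exactly the pairs (v , ⊤) with v an old
-- element.  Dually, _<₋_ adds exactly the pairs (⊥ , v) with v an old element.
_^⊤ : Digraph → Digraph
G ^⊤ = record
  { V      = V ⁺
  ; size   = suc size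
  ; finite = Maybe-finite finite
  ; _E_    = _<⁺_ _E_
  ; _E?_   = <⁺-dec _E_ _E?_
  ; irrefl = <⁺-irrefl-≡ _E_ irrefl
  }
  where open Digraph G

_^⊥ : Digraph → Digraph
G ^⊥ = record
  { V      = V ₋
  ; size   = suc size
  ; finite = Maybe-finite finite
  ; _E_    = _<₋_ _E_
  ; _E?_   = <₋-dec _E_ _E?_
  ; irrefl = <₋-irrefl-≡ _E_ irrefl
  }
  where open Digraph G

_^⊤⊥ : Digraph → Digraph
G ^⊤⊥ = (G ^⊤) ^⊥

module _ (G : Digraph) where
  open Digraph G

  IsPolymorphism : ∀ {k} → (Vec V k → V) → Set
  IsPolymorphism {k} f = ∀ {as bs : Vec V k} → Pointwise _E_ as bs → f as E f bs

  IsIdempotent : ∀ {k} → (Vec V k → V) → Set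
  IsIdempotent {k} f = ∀ x → f (replicate k x) ≡ x

  IsIdempotentPolymorphism : ∀ {k} → (Vec V k → V) → Set
  IsIdempotentPolymorphism f = IsPolymorphism f × IsIdempotent f

  -- The operations d₀ , … , dₙ and e₀ , … , eₙ are indexed by Fin (suc n); an
  -- index i < n is an i : Fin n, with inject₁ i standing for i and suc i for
  -- i + 1.
  record HobbyMcKenzie : Set where
    field
      n   : ℕ
      d e : Fin (suc n) → Vec V 3 → V
      p   : Vec V 3 → V

      d-poly : ∀ i → IsIdempotentPolymorphism (d i)
      p-poly : IsIdempotentPolymorphism p
      e-poly : ∀ i → IsIdempotentPolymorphism (e i)

      d-first : ∀ x y z → x ≡ d zero (x ∷ y ∷ z ∷ [])
      e-last  : ∀ x y z → e (fromℕ n) (x ∷ y ∷ z ∷ []) ≡ z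

      d-even-xyy : ∀ (i : Fin n) → 2 ∣ toℕ i → ∀ x y →
                   d (inject₁ i) (x ∷ y ∷ y ∷ []) ≡ d (suc i) (x ∷ y ∷ y ∷ [])
      e-even-xyy : ∀ (i : Fin n) → 2 ∣ toℕ i → ∀ x y →
                   e (inject₁ i) (x ∷ y ∷ y ∷ []) ≡ e (suc i) (x ∷ y ∷ y ∷ [])

      d-odd-xxy  : ∀ (i : Fin n) → 2 ∤ toℕ i → ∀ x y →
                   d (inject₁ i) (x ∷ x ∷ y ∷ []) ≡ d (suc i) (x ∷ x ∷ y ∷ [])
      e-odd-xxy  : ∀ (i : Fin n) → 2 ∤ toℕ i → ∀ x y →
                   e (inject₁ i) (x ∷ x ∷ y ∷ []) ≡ e (suc i) (x ∷ x ∷ y ∷ [])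

      d-p-xyy : ∀ x y → d (fromℕ n) (x ∷ y ∷ y ∷ []) ≡ p (x ∷ y ∷ y ∷ [])
      p-e-xxy : ∀ x y → p (x ∷ x ∷ y ∷ []) ≡ e zero (x ∷ x ∷ y ∷ [])

      d-odd-xyx  : ∀ (i : Fin n) → 2 ∤ toℕ i → ∀ x y →
                   d (inject₁ i) (x ∷ y ∷ x ∷ []) ≡ d (suc i) (x ∷ y ∷ x ∷ [])
      e-even-xyx : ∀ (j : Fin n) → 2 ∣ toℕ j → ∀ x y →
                   e (inject₁ j) (x ∷ y ∷ x ∷ []) ≡ e (suc j) (x ∷ y ∷ x ∷ [])

{-# OPTIONS --safe #-}
-- An idempotent polymorphism of G^⊤ preserves V, because V consists of the
-- vertices with an edge to the fixed vertex ⊤; so the operations restrict to G.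
--
-- Conversely, an operation of G extends to G^⊤ by the value ⊤ on all triples
-- that contain ⊤: no edge leaves ⊤, so this is again a polymorphism, and all
-- identities in which both sides contain the same variables survive.  Only
-- d₀ = π₁ and eₙ = π₃ are spoilt.  This is repaired by lengthening the two
-- chains: π₁ is joined to its extension through the operation that agrees with
-- it, except that (x , ⊤ , ⊤) goes to x, and dually for π₃.  For the parities
-- to match at the end of the second chain, n is first made even.
--
-- The case of G^⊥ follows by reversing all edges.
module Submission where

open import Defs
open import Data.Fin.Base using (Fin; zero; suc; toℕ; fromℕ; inject₁)
open import Data.Maybe.Properties using (just-injective)
open import Data.Nat.Base using (ℕ; zero; suc)
open import Data.Nat.Divisibility using (_∣_; _∤_; _∣?_; _∣0; ∣-refl; ∣1⇒≡1; ∣m∣n⇒∣m+n; ∣m+n∣m⇒∣n)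
open import Data.Nat.Properties using (+-comm)
open import Data.Product.Base using (∃; Σ-syntax; _,_; proj₁; proj₂)
open import Data.Vec.Base using (Vec; []; _∷_; replicate; map)
open import Data.Vec.Functional as Vector using (Vector)
open import Data.Vec.Relation.Binary.Pointwise.Inductive as Pointwise using (Pointwise; []; _∷_)
open import Function.Base using (id; _∘_; flip)
open import Function.Bundles using (_⇔_; mk⇔)
open import Function.Properties.Equivalence using () renaming (trans to ⇔-trans)
open import Level using (0ℓ)
open import Relation.Binary.Construct.Add.Infimum.Strict using (⊥₋<[_]) renaming ([_] to [_]₋)
open import Relation.Binary.Construct.Add.Supremum.Strict using (_<⁺_; [_]; [_]<⊤⁺)
open import Relation.Binary.Core using (Rel)
open import Relation.Binary.Definitions using (Decidable; Irreflexive)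
open import Relation.Binary.PropositionalEquality using (_≡_; refl; sym; trans; cong; subst; subst₂)
open import Relation.Nullary.Construct.Add.Supremum using (_⁺; ⊤⁺; [_])
open import Relation.Nullary.Decidable using (yes; no)
open import Relation.Nullary.Negation using (contradiction)

private
  variable
    A : Set
    m : ℕ

-- Parity of chain indices.

2∣2+n⇒2∣n : ∀ {n} → 2 ∣ suc (suc n) → 2 ∣ n
2∣2+n⇒2∣n 2∣2+n = ∣m+n∣m⇒∣n 2∣2+n ∣-refl

2∣n⇒2∣2+n : ∀ {n} → 2 ∣ n → 2 ∣ suc (suc n)
2∣n⇒2∣2+n = ∣m∣n⇒∣m+n ∣-refl

2∣n⇒2∤1+n : ∀ {n} → 2 ∣ n → 2 ∤ suc n
2∣n⇒2∤1+n {n} 2∣n 2∣1+n =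
  contradiction (∣1⇒≡1 (∣m+n∣m⇒∣n (subst (2 ∣_) (+-comm 1 n) 2∣1+n) 2∣n)) λ ()

2∤n⇒2∣1+n : ∀ n → 2 ∤ n → 2 ∣ suc n
2∤n⇒2∣1+n zero          2∤0   = contradiction (2 ∣0) 2∤0
2∤n⇒2∣1+n (suc zero)    _     = ∣-refl
2∤n⇒2∣1+n (suc (suc n)) 2∤2+n = 2∣n⇒2∣2+n (2∤n⇒2∣1+n n (2∤2+n ∘ 2∣n⇒2∣2+n))

-- Finite sequences of operations and relations between neighbours.

infixl 5 _∷ʳ_

_∷ʳ_ : Vector A m → A → Vector A (suc m)
_∷ʳ_ {m = zero}  f a zero    = a
_∷ʳ_ {m = suc _} f a zero    = f zero
_∷ʳ_ {m = suc _} f a (suc i) = (f ∘ suc ∷ʳ a) i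

∷ʳ-fromℕ : (f : Vector A m) (a : A) → (f ∷ʳ a) (fromℕ m) ≡ a
∷ʳ-fromℕ {m = zero}  f a = refl
∷ʳ-fromℕ {m = suc _} f a = ∷ʳ-fromℕ (f ∘ suc) a

∷ʳ-all : (P : A → Set) (f : Vector A m) {a : A} →
         (∀ i → P (f i)) → P a → ∀ i → P ((f ∷ʳ a) i)
∷ʳ-all {m = zero}  P f pf pa zero    = pa
∷ʳ-all {m = suc _} P f pf pa zero    = pf zero
∷ʳ-all {m = suc _} P f pf pa (suc i) = ∷ʳ-all P (f ∘ suc) (pf ∘ suc) pa i

-- The relation may depend on the position, so that parity conditions on the index fit in.
Linked : (ℕ → Rel A 0ℓ) → Vector A (suc m) → Set
Linked R f = ∀ i → R (toℕ i) (f (inject₁ i)) (f (suc i))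

∷-linked : (R : ℕ → Rel A 0ℓ) (f : Vector A (suc m)) {a : A} →
           R 0 a (f zero) → Linked (R ∘ suc) f → Linked R (a Vector.∷ f)
∷-linked R f r rs zero    = r
∷-linked R f r rs (suc i) = rs i

∷ʳ-linked : (R : ℕ → Rel A 0ℓ) (f : Vector A (suc m)) {a : A} →
            Linked R f → R m (f (fromℕ m)) a → Linked R (f ∷ʳ a)
∷ʳ-linked {m = zero}  R f rs r zero    = r
∷ʳ-linked {m = suc _} R f rs r zero    = rs zero
∷ʳ-linked {m = suc _} R f rs r (suc i) = ∷ʳ-linked (R ∘ suc) (f ∘ suc) (rs ∘ suc) r i

∷ʳ²-linked : (R : ℕ → Rel A 0ℓ) (f : Vector A (suc m)) {a b : A} →
             Linked R f → R m (f (fromℕ m)) a → R (suc m) a b →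
             Linked R (f ∷ʳ a ∷ʳ b)
∷ʳ²-linked {m = m} R f {a} {b} rs r s =
  ∷ʳ-linked R (f ∷ʳ a) (∷ʳ-linked R f rs r)
    -- The last entry of `f ∷ʳ a` is `a` only up to a proof, not by computation, since `m` is a
    -- variable.
    (subst (λ c → R (suc m) c b) (sym (∷ʳ-fromℕ f a)) s)

-- Ternary operations on `A ⁺` and the identities between them.

Op : Set → Set
Op A = Vec A 3 → A

Pattern : Set₁
Pattern = {A : Set} → A → A → Vec A 3

xyy xxy xyx : Pattern
xyy x y = x ∷ y ∷ y ∷ []
xxy x y = x ∷ x ∷ y ∷ []
xyx x y = x ∷ y ∷ x ∷ []

AgreeOn : Pattern → Rel (Op A) 0ℓ
AgreeOn t f g = ∀ x y → f (t x y) ≡ g (t x y)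

-- With `P` a parity, `Linked (AgreeWhen P t)` unfolds to exactly the form of the chain identities
-- in `HobbyMcKenzie`.
AgreeWhen : (ℕ → Set) → Pattern → ℕ → Rel (Op A) 0ℓ
AgreeWhen P t k f g = P k → AgreeOn t f g

private
  variable
    f g : Op A

π₁ π₃ : Op A
π₁ (x ∷ _ ∷ _ ∷ []) = x
π₃ (_ ∷ _ ∷ z ∷ []) = z

absorb : Op A → Op (A ⁺)
absorb f ([ x ] ∷ [ y ] ∷ [ z ] ∷ []) = [ f (x ∷ y ∷ z ∷ []) ]
absorb f _                            = ⊤⁺

first : Op (A ⁺)
first ([ x ] ∷ ⊤⁺ ∷ ⊤⁺ ∷ []) = [ x ]
first xs                     = absorb π₁ xs

last : Op (A ⁺)
last (⊤⁺ ∷ ⊤⁺ ∷ [ z ] ∷ []) = [ z ]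
last xs                     = absorb π₃ xs

absorb-xyy : AgreeOn xyy f g → AgreeOn xyy (absorb f) (absorb g)
absorb-xyy eq [ x ] [ y ] = cong [_] (eq x y)
absorb-xyy eq [ x ] ⊤⁺    = refl
absorb-xyy eq ⊤⁺    _     = refl

absorb-xxy : AgreeOn xxy f g → AgreeOn xxy (absorb f) (absorb g)
absorb-xxy eq [ x ] [ y ] = cong [_] (eq x y)
absorb-xxy eq [ x ] ⊤⁺    = refl
absorb-xxy eq ⊤⁺    _     = refl

absorb-xyx : AgreeOn xyx f g → AgreeOn xyx (absorb f) (absorb g)
absorb-xyx eq [ x ] [ y ] = cong [_] (eq x y)
absorb-xyx eq [ x ] ⊤⁺    = refl
absorb-xyx eq ⊤⁺    _     = refl

-- On triples (x , y , y), `π₁` and `absorb π₁` differ only at (x , ⊤ , ⊤) with x old, which is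
-- where `first` follows `π₁`.
π₁-first-xyy : AgreeOn {A ⁺} xyy π₁ first
π₁-first-xyy [ x ] [ y ] = refl
π₁-first-xyy [ x ] ⊤⁺    = refl
π₁-first-xyy ⊤⁺    _     = refl

-- The exceptional triples of `first` have an old first entry and two entries ⊤, so they are never
-- of the form (x , x , y) or (x , y , x).
first-absorb-xxy : AgreeOn xxy π₁ f → AgreeOn xxy first (absorb f)
first-absorb-xxy eq [ x ] [ y ] = cong [_] (eq x y)
first-absorb-xxy eq [ x ] ⊤⁺    = refl
first-absorb-xxy eq ⊤⁺    _     = refl

first-absorb-xyx : AgreeOn xyx π₁ f → AgreeOn xyx first (absorb f)
first-absorb-xyx eq [ x ] [ y ] = cong [_] (eq x y)
first-absorb-xyx eq [ x ] ⊤⁺    = refl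
first-absorb-xyx eq ⊤⁺    _     = refl

-- The exceptional triples (⊤ , ⊤ , z) of `last`, with z old, are never of the form (x , y , y) or
-- (x , y , x).
absorb-last-xyy : AgreeOn xyy f π₃ → AgreeOn xyy (absorb f) last
absorb-last-xyy eq [ x ] [ y ] = cong [_] (eq x y)
absorb-last-xyy eq [ x ] ⊤⁺    = refl
absorb-last-xyy eq ⊤⁺    [ y ] = refl
absorb-last-xyy eq ⊤⁺    ⊤⁺    = refl

absorb-last-xyx : AgreeOn xyx f π₃ → AgreeOn xyx (absorb f) last
absorb-last-xyx eq [ x ] [ y ] = cong [_] (eq x y)
absorb-last-xyx eq [ x ] ⊤⁺    = refl
absorb-last-xyx eq ⊤⁺    [ y ] = refl
absorb-last-xyx eq ⊤⁺    ⊤⁺    = refl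

last-π₃-xxy : AgreeOn {A ⁺} xxy last π₃
last-π₃-xxy [ x ] [ y ] = refl
last-π₃-xxy [ x ] ⊤⁺    = refl
last-π₃-xxy ⊤⁺    [ y ] = refl
last-π₃-xxy ⊤⁺    ⊤⁺    = refl

-- Polymorphisms of `G ^⊤`.

module _ (G : Digraph) where
  open Digraph G

  π₁-poly : IsIdempotentPolymorphism G π₁
  π₁-poly = (λ { (e ∷ _ ∷ _ ∷ []) → e }) , λ _ → refl

  π₃-poly : IsIdempotentPolymorphism G π₃
  π₃-poly = (λ { (_ ∷ _ ∷ e ∷ []) → e }) , λ _ → refl

  -- Edges start at old vertices, so the value at the source triple is old. It has an edge to ⊤,
  -- which is the value at the target as soon as one target is ⊤.
  absorb-poly : IsIdempotentPolymorphism G f → IsIdempotentPolymorphism (G ^⊤) (absorb f)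
  absorb-poly (f-poly , f-idem) = poly , λ { [ x ] → cong [_] (f-idem x) ; ⊤⁺ → refl }
    where
    poly : IsPolymorphism (G ^⊤) (absorb _)
    poly ([ a ]   ∷ [ b ]   ∷ [ c ]   ∷ []) = [ f-poly (a ∷ b ∷ c ∷ []) ]
    poly ([ _ ]   ∷ [ _ ]   ∷ [ _ ]<⊤⁺ ∷ []) = [ _ ]<⊤⁺
    poly ([ _ ]   ∷ [ _ ]<⊤⁺ ∷ [ _ ]   ∷ []) = [ _ ]<⊤⁺
    poly ([ _ ]   ∷ [ _ ]<⊤⁺ ∷ [ _ ]<⊤⁺ ∷ []) = [ _ ]<⊤⁺
    poly ([ _ ]<⊤⁺ ∷ [ _ ]   ∷ [ _ ]   ∷ []) = [ _ ]<⊤⁺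
    poly ([ _ ]<⊤⁺ ∷ [ _ ]   ∷ [ _ ]<⊤⁺ ∷ []) = [ _ ]<⊤⁺
    poly ([ _ ]<⊤⁺ ∷ [ _ ]<⊤⁺ ∷ [ _ ]   ∷ []) = [ _ ]<⊤⁺
    poly ([ _ ]<⊤⁺ ∷ [ _ ]<⊤⁺ ∷ [ _ ]<⊤⁺ ∷ []) = [ _ ]<⊤⁺

  first-poly : IsIdempotentPolymorphism (G ^⊤) first
  first-poly = poly , λ { [ x ] → refl ; ⊤⁺ → refl }
    where
    poly : IsPolymorphism (G ^⊤) first
    poly ([ a ]   ∷ [ _ ]   ∷ [ _ ]   ∷ []) = [ a ]
    poly ([ _ ]   ∷ [ _ ]   ∷ [ _ ]<⊤⁺ ∷ []) = [ _ ]<⊤⁺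
    poly ([ _ ]   ∷ [ _ ]<⊤⁺ ∷ [ _ ]   ∷ []) = [ _ ]<⊤⁺
    -- The target triple is exceptional and goes to its first entry, so the edge in the first
    -- coordinate is the one required.
    poly ([ a ]   ∷ [ _ ]<⊤⁺ ∷ [ _ ]<⊤⁺ ∷ []) = [ a ]
    poly ([ _ ]<⊤⁺ ∷ [ _ ]   ∷ [ _ ]   ∷ []) = [ _ ]<⊤⁺
    poly ([ _ ]<⊤⁺ ∷ [ _ ]   ∷ [ _ ]<⊤⁺ ∷ []) = [ _ ]<⊤⁺
    poly ([ _ ]<⊤⁺ ∷ [ _ ]<⊤⁺ ∷ [ _ ]   ∷ []) = [ _ ]<⊤⁺
    poly ([ _ ]<⊤⁺ ∷ [ _ ]<⊤⁺ ∷ [ _ ]<⊤⁺ ∷ []) = [ _ ]<⊤⁺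

  last-poly : IsIdempotentPolymorphism (G ^⊤) last
  last-poly = poly , λ { [ x ] → refl ; ⊤⁺ → refl }
    where
    poly : IsPolymorphism (G ^⊤) last
    poly ([ _ ]   ∷ [ _ ]   ∷ [ c ]   ∷ []) = [ c ]
    poly ([ _ ]   ∷ [ _ ]   ∷ [ _ ]<⊤⁺ ∷ []) = [ _ ]<⊤⁺
    poly ([ _ ]   ∷ [ _ ]<⊤⁺ ∷ [ _ ]   ∷ []) = [ _ ]<⊤⁺
    poly ([ _ ]   ∷ [ _ ]<⊤⁺ ∷ [ _ ]<⊤⁺ ∷ []) = [ _ ]<⊤⁺
    poly ([ _ ]<⊤⁺ ∷ [ _ ]   ∷ [ _ ]   ∷ []) = [ _ ]<⊤⁺
    poly ([ _ ]<⊤⁺ ∷ [ _ ]   ∷ [ _ ]<⊤⁺ ∷ []) = [ _ ]<⊤⁺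
    poly ([ _ ]<⊤⁺ ∷ [ _ ]<⊤⁺ ∷ [ c ]   ∷ []) = [ c ]
    poly ([ _ ]<⊤⁺ ∷ [ _ ]<⊤⁺ ∷ [ _ ]<⊤⁺ ∷ []) = [ _ ]<⊤⁺

-- From `G` to `G ^⊤`.

-- Repeating the last operation of both chains changes the parity of `n`; the new links satisfy
-- every identity by reflexivity.
even-length : ∀ {G} → HobbyMcKenzie G → Σ[ h ∈ HobbyMcKenzie G ] 2 ∣ HobbyMcKenzie.n h
even-length {G} h with 2 ∣? HobbyMcKenzie.n h
... | yes 2∣n = h , 2∣n
... | no  2∤n = record
  { n          = suc n
  ; d          = d ∷ʳ d (fromℕ n)
  ; e          = e ∷ʳ e (fromℕ n)
  ; p          = p
  ; d-poly     = ∷ʳ-all (IsIdempotentPolymorphism G) d d-poly (d-poly (fromℕ n))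
  ; p-poly     = p-poly
  ; e-poly     = ∷ʳ-all (IsIdempotentPolymorphism G) e e-poly (e-poly (fromℕ n))
  ; d-first    = d-first
  ; e-last     = λ x y z → trans (cong (λ f → f (x ∷ y ∷ z ∷ [])) (∷ʳ-fromℕ e (e (fromℕ n)))) (e-last x y z)
  ; d-even-xyy = ∷ʳ-linked (AgreeWhen (2 ∣_) xyy) d d-even-xyy (λ _ _ _ → refl)
  ; e-even-xyy = ∷ʳ-linked (AgreeWhen (2 ∣_) xyy) e e-even-xyy (λ _ _ _ → refl)
  ; d-odd-xxy  = ∷ʳ-linked (AgreeWhen (2 ∤_) xxy) d d-odd-xxy (λ _ _ _ → refl)
  ; e-odd-xxy  = ∷ʳ-linked (AgreeWhen (2 ∤_) xxy) e e-odd-xxy (λ _ _ _ → refl)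
  ; d-p-xyy    = λ x y → trans (cong (λ f → f (xyy x y)) (∷ʳ-fromℕ d (d (fromℕ n)))) (d-p-xyy x y)
  ; p-e-xxy    = p-e-xxy
  ; d-odd-xyx  = ∷ʳ-linked (AgreeWhen (2 ∤_) xyx) d d-odd-xyx (λ _ _ _ → refl)
  ; e-even-xyx = ∷ʳ-linked (AgreeWhen (2 ∣_) xyx) e e-even-xyx (λ _ _ _ → refl)
  } , 2∤n⇒2∣1+n n 2∤n
  where open HobbyMcKenzie h

-- The two operations put before the `d` chain shift its indices by 2 and so keep their parity. At
-- the end of the `e` chain, the link to `last` has index `n` and must be even, as it satisfies the
-- xyy and xyx identities; the link from `last` to `π₃` satisfies only the xxy identity and must be
-- odd.
⊤-extend : ∀ {G} → HobbyMcKenzie G → HobbyMcKenzie (G ^⊤)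
⊤-extend {G} h₀ with even-length h₀
... | h , 2∣n = record
  { n          = suc (suc n)
  ; d          = d⁺
  ; e          = e⁺
  ; p          = absorb p
  ; d-poly     = λ { zero          → π₁-poly (G ^⊤)
                   ; (suc zero)    → first-poly G
                   ; (suc (suc i)) → absorb-poly G (d-poly i) }
  ; p-poly     = absorb-poly G p-poly
  ; e-poly     = ∷ʳ-all (IsIdempotentPolymorphism (G ^⊤)) (absorb ∘ e ∷ʳ last)
                   (∷ʳ-all (IsIdempotentPolymorphism (G ^⊤)) (absorb ∘ e) (absorb-poly G ∘ e-poly) (last-poly G))
                   (π₃-poly (G ^⊤))
  ; d-first    = λ _ _ _ → refl
  ; e-last     = λ x y z → cong (λ f → f (x ∷ y ∷ z ∷ [])) (∷ʳ-fromℕ (absorb ∘ e ∷ʳ last) π₃)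
  ; d-even-xyy = λ { zero          _     → π₁-first-xyy
                   ; (suc zero)    2∣1   → contradiction 2∣1 (2∣n⇒2∤1+n (2 ∣0))
                   ; (suc (suc i)) 2∣2+i → absorb-xyy (d-even-xyy i (2∣2+n⇒2∣n 2∣2+i)) }
  ; e-even-xyy = ∷ʳ²-linked (AgreeWhen (2 ∣_) xyy) (absorb ∘ e)
                   (λ i 2∣i → absorb-xyy (e-even-xyy i 2∣i))
                   (λ _ → absorb-last-xyy λ x y → e-last x y y)
                   (λ 2∣1+n → contradiction 2∣1+n 2∤1+n)
  ; d-odd-xxy  = λ { zero          2∤0   → contradiction (2 ∣0) 2∤0
                   ; (suc zero)    _     → first-absorb-xxy λ x y → d-first x x y
                   ; (suc (suc i)) 2∤2+i → absorb-xxy (d-odd-xxy i (2∤2+i ∘ 2∣n⇒2∣2+n)) }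
  ; e-odd-xxy  = ∷ʳ²-linked (AgreeWhen (2 ∤_) xxy) (absorb ∘ e)
                   (λ i 2∤i → absorb-xxy (e-odd-xxy i 2∤i))
                   (λ 2∤n → contradiction 2∣n 2∤n)
                   (λ _ → last-π₃-xxy)
  -- The new operations sit at the outer ends, so the two identities around `p` are the absorbed old
  -- ones.
  ; d-p-xyy    = absorb-xyy d-p-xyy
  ; p-e-xxy    = absorb-xxy p-e-xxy
  ; d-odd-xyx  = λ { zero          2∤0   → contradiction (2 ∣0) 2∤0
                   ; (suc zero)    _     → first-absorb-xyx λ x y → d-first x y x
                   ; (suc (suc i)) 2∤2+i → absorb-xyx (d-odd-xyx i (2∤2+i ∘ 2∣n⇒2∣2+n)) }
  ; e-even-xyx = ∷ʳ²-linked (AgreeWhen (2 ∣_) xyx) (absorb ∘ e)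
                   (λ i 2∣i → absorb-xyx (e-even-xyx i 2∣i))
                   (λ _ → absorb-last-xyx λ x y → e-last x y x)
                   (λ 2∣1+n → contradiction 2∣1+n 2∤1+n)
  }
  where
  open HobbyMcKenzie h

  2∤1+n : 2 ∤ suc n
  2∤1+n = 2∣n⇒2∤1+n 2∣n

  d⁺ e⁺ : Vector (Op (Digraph.V G ⁺)) (suc (suc (suc n)))
  d⁺ = π₁ Vector.∷ first Vector.∷ absorb ∘ d
  e⁺ = absorb ∘ e ∷ʳ last ∷ʳ π₃

-- From `G ^⊤` to `G`.

module _ (G : Digraph) where
  open Digraph G

  restrict-∃ : {F : Op (V ⁺)} → IsIdempotentPolymorphism (G ^⊤) F →
               ∀ xs → ∃ λ v → F (map [_] xs) ≡ [ v ]
  restrict-∃ {F} (F-poly , F-idem) xs =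
    -- `F` preserves the edges from the entries of `xs` to ⊤, and idempotence identifies the
    -- endpoint of the resulting edge as ⊤.
    source (subst (F (map [_] xs) <⊤_) (F-idem ⊤⁺) (F-poly (below xs)))
    where
    _<⊤_ = _<⁺_ _E_

    source : ∀ {a b} → a <⊤ b → ∃ λ v → a ≡ [ v ]
    source [ _ ]    = _ , refl
    source [ v ]<⊤⁺ = v , refl

    below : ∀ {k} (xs : Vec V k) → Pointwise _<⊤_ (map [_] xs) (replicate k ⊤⁺)
    below []       = []
    below (x ∷ xs) = [ x ]<⊤⁺ ∷ below xs

  restrict : {F : Op (V ⁺)} → IsIdempotentPolymorphism (G ^⊤) F → Op V
  restrict F-poly xs = proj₁ (restrict-∃ F-poly xs)

  restrict-≡ : {F : Op (V ⁺)} (F-poly : IsIdempotentPolymorphism (G ^⊤) F) →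
               ∀ xs → F (map [_] xs) ≡ [ restrict F-poly xs ]
  restrict-≡ F-poly xs = proj₂ (restrict-∃ F-poly xs)

  -- Injectivity of the embedding of `V` lets identities of `F` descend to its restriction.
  restrict-unique : {F : Op (V ⁺)} (F-poly : IsIdempotentPolymorphism (G ^⊤) F) →
                    ∀ xs {v} → F (map [_] xs) ≡ [ v ] → restrict F-poly xs ≡ v
  restrict-unique F-poly xs eq = just-injective (trans (sym (restrict-≡ F-poly xs)) eq)

  restrict-cong : {F H : Op (V ⁺)}
                  (F-poly : IsIdempotentPolymorphism (G ^⊤) F)
                  (H-poly : IsIdempotentPolymorphism (G ^⊤) H) →
                  ∀ xs → F (map [_] xs) ≡ H (map [_] xs) →
                  restrict F-poly xs ≡ restrict H-poly xs
  restrict-cong F-poly H-poly xs eq =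
    restrict-unique F-poly xs (trans eq (restrict-≡ H-poly xs))

  restrict-poly : {F : Op (V ⁺)} (F-poly : IsIdempotentPolymorphism (G ^⊤) F) →
                  IsIdempotentPolymorphism G (restrict F-poly)
  restrict-poly {F} F-poly = poly , λ x → restrict-unique F-poly (replicate 3 x) (proj₂ F-poly [ x ])
    where
    [-]-injective : ∀ {a b} → _<⁺_ _E_ [ a ] [ b ] → a E b
    [-]-injective [ aEb ] = aEb

    map-[-] : ∀ {k} {as bs : Vec V k} → Pointwise _E_ as bs →
              Pointwise (_<⁺_ _E_) (map [_] as) (map [_] bs)
    map-[-] []            = []
    map-[-] (aEb ∷ asEbs) = [ aEb ] ∷ map-[-] asEbs

    poly : IsPolymorphism G (restrict F-poly)
    poly {as} {bs} asEbs = [-]-injective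
      (subst₂ (_<⁺_ _E_) (restrict-≡ F-poly as) (restrict-≡ F-poly bs)
        (proj₁ F-poly (map-[-] asEbs)))

⊤-restrict : ∀ {G} → HobbyMcKenzie (G ^⊤) → HobbyMcKenzie G
⊤-restrict {G} h = record
  { n          = n
  ; d          = restrict G ∘ d-poly
  ; e          = restrict G ∘ e-poly
  ; p          = restrict G p-poly
  ; d-poly     = restrict-poly G ∘ d-poly
  ; p-poly     = restrict-poly G p-poly
  ; e-poly     = restrict-poly G ∘ e-poly
  ; d-first    = λ x y z → sym (restrict-unique G (d-poly zero) (x ∷ y ∷ z ∷ []) (sym (d-first _ _ _)))
  ; e-last     = λ x y z → restrict-unique G (e-poly (fromℕ n)) (x ∷ y ∷ z ∷ []) (e-last _ _ _)
  ; d-even-xyy = λ i 2∣i x y → restrict-cong G (d-poly _) (d-poly _) (xyy x y) (d-even-xyy i 2∣i _ _)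
  ; e-even-xyy = λ i 2∣i x y → restrict-cong G (e-poly _) (e-poly _) (xyy x y) (e-even-xyy i 2∣i _ _)
  ; d-odd-xxy  = λ i 2∤i x y → restrict-cong G (d-poly _) (d-poly _) (xxy x y) (d-odd-xxy i 2∤i _ _)
  ; e-odd-xxy  = λ i 2∤i x y → restrict-cong G (e-poly _) (e-poly _) (xxy x y) (e-odd-xxy i 2∤i _ _)
  ; d-p-xyy    = λ x y → restrict-cong G (d-poly _) p-poly (xyy x y) (d-p-xyy _ _)
  ; p-e-xxy    = λ x y → restrict-cong G p-poly (e-poly _) (xxy x y) (p-e-xxy _ _)
  ; d-odd-xyx  = λ i 2∤i x y → restrict-cong G (d-poly _) (d-poly _) (xyx x y) (d-odd-xyx i 2∤i _ _)
  ; e-even-xyx = λ i 2∣i x y → restrict-cong G (e-poly _) (e-poly _) (xyx x y) (e-even-xyx i 2∣i _ _)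
  }
  where open HobbyMcKenzie h

⊤-⇔ : ∀ G → HobbyMcKenzie (G ^⊤) ⇔ HobbyMcKenzie G
⊤-⇔ _ = mk⇔ ⊤-restrict ⊤-extend

-- Reversal of edges and the case of `G ^⊥`.

module _ (G : Digraph) {_E′_ : Rel (Digraph.V G) 0ℓ}
         (_E′?_ : Decidable _E′_) (irrefl′ : Irreflexive _≡_ _E′_) where
  open Digraph G

  withEdges : Digraph
  withEdges = record G { _E_ = _E′_ ; _E?_ = _E′?_ ; irrefl = irrefl′ }

  -- An operation preserving a relation preserves its converse. The identities do not mention edges,
  -- and the vertex set stays the same, so they carry over verbatim.
  reverse-edges : (∀ {x y} → x E y → y E′ x) → (∀ {x y} → x E′ y → y E x) →
                  HobbyMcKenzie G → HobbyMcKenzie withEdges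
  reverse-edges to from h = record
    { HobbyMcKenzie h
    ; d-poly = reverse-poly ∘ d-poly
    ; p-poly = reverse-poly p-poly
    ; e-poly = reverse-poly ∘ e-poly
    }
    where
    open HobbyMcKenzie h using (d-poly; p-poly; e-poly)

    reverse-poly : {f : Op V} → IsIdempotentPolymorphism G f → IsIdempotentPolymorphism withEdges f
    reverse-poly (f-poly , f-idem) =
      (λ asE′bs → to (f-poly (Pointwise.sym from asE′bs))) , f-idem

converse : Digraph → Digraph
converse G = withEdges G {flip _E_} (flip _E?_) (λ x≡y yEx → irrefl (sym x≡y) yEx)
  where open Digraph G

converse-⇔ : ∀ G → HobbyMcKenzie (converse G) ⇔ HobbyMcKenzie G
converse-⇔ G = mk⇔
  (reverse-edges (converse G) (Digraph._E?_ G) (Digraph.irrefl G) id id)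
  (reverse-edges G _ _ id id)

-- Both digraphs have the vertex set `Maybe V`, with ⊥ and ⊤ the same element `nothing`, so they
-- differ only in the direction of their edges.
⊥-⇔-converse-⊤ : ∀ G → HobbyMcKenzie (G ^⊥) ⇔ HobbyMcKenzie (converse G ^⊤)
⊥-⇔-converse-⊤ G = mk⇔
  (reverse-edges (G ^⊥) (Digraph._E?_ (converse G ^⊤)) (Digraph.irrefl (converse G ^⊤)) to from)
  (reverse-edges (converse G ^⊤) (Digraph._E?_ (G ^⊥)) (Digraph.irrefl (G ^⊥)) from to)
  where
  to : ∀ {x y} → Digraph._E_ (G ^⊥) x y → Digraph._E_ (converse G ^⊤) y x
  to ⊥₋<[ v ] = [ v ]<⊤⁺
  to [ xEy ]₋ = [ xEy ]

  from : ∀ {x y} → Digraph._E_ (converse G ^⊤) x y → Digraph._E_ (G ^⊥) y x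
  from [ v ]<⊤⁺ = ⊥₋<[ v ]
  from [ xEy ]  = [ xEy ]₋

⊥-⇔ : ∀ G → HobbyMcKenzie (G ^⊥) ⇔ HobbyMcKenzie G
⊥-⇔ G = ⇔-trans (⊥-⇔-converse-⊤ G) (⇔-trans (⊤-⇔ (converse G)) (converse-⇔ G))

theorem5p5 : (G : Digraph) → HobbyMcKenzie (G ^⊤⊥) ⇔ HobbyMcKenzie G
theorem5p5 G = ⇔-trans (⊥-⇔ (G ^⊤)) (⊤-⇔ G)
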